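{- Algorithm B (defined in the context) has migration factor at most $\frac34$, and on every input whose optimal offline makespan is $1$ it produces a schedule with makespan at most $1.25$. Hence for every $M\ge\frac34$ there is a semi-online algorithm with migration factor $M$ and competitive ratio at most $\frac54$.
   Context: Model (two hierarchical machines with migration, bin stretching). Jobs $1,2,\dots,n$ arrive one by one ($n$ unknown in advance). Job $j$ has a size $p_j>0$ and a grade of service (GoS) $g_j\in\{1,2\}$; a job of GoS $1$ may only be processed on machine $m_1$, a job of GoS $2$ may be processed on $m_1$ or on $m_2$. The load of a machine is the total size of the jobs assigned to it, and the makespan is the maximum load. When job $j$ arrives, the algorithm must assign it to a machine, and at the same time it may reassign (migrate) previously arrived jobs to other machines (respecting the GoS constraints), provided that the total size of the migrated jobs is at most $M\cdot p_j$; $M\ge 0$ is the migration factor. Bin stretching: the optimal offline makespan of the complete input is known in advance and scaled to $1$. The competitive ratio is the supremum over inputs of (algorithm's makespan)/(optimal makespan). Notation: $Y_{j}$ is the set of jobs on $m_2$ just after job $j$ has been handled (including migrations), $y_j$ its total size, $y_0=0$. $p^{\max Y}_j$ and $p^{\max Y,2}_j$ are the largest and second largest sizes of jobs in $Y_{j-1}$ (each defined as $0$ if it does not exist), and $j^{\max Y}$ is a job of $Y_{j-1}$ of size $p^{\max Y}_j$. "Sorted $Y_{j-1}$" means the jobs of $Y_{j-1}$ listed in non-increasing order of size; $w_j$ denotes the total size of the set $W$ chosen when handling $j$. Algorithm B. On arrival of job $j$: Step 2: if $g_j=1$ or $y_{j-1}\ge 0.75$, assign $j$ to $m_1$. Step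 3: else if $y_{j-1}+p_j\le 1.25$, assign $j$ to $m_2$. Step 4: else if $p_j\ge 0.75$: let $W$ be the longest prefix of sorted $Y_{j-1}$ with total size at most $0.75p_j$ (possibly empty). If $y_{j-1}-w_j+p_j>1.25$, assign $j$ to $m_1$ (no migration); otherwise migrate the jobs of $W$ to $m_1$ and assign $j$ to $m_2$. Step 5: else (so $p_j<0.75$): if $p_j+p^{\max Y}_j>1.25$, assign $j$ to $m_1$. Otherwise choose $W$ as follows: if $p^{\max Y}_j\ge y_{j-1}/2$, let $W=Y_{j-1}\setminus\{j^{\max Y}\}$; if $0.25\le p^{\max Y}_j<y_{j-1}/2$, let $W=\{j^{\max Y}\}$; if $p^{\max Y}_j<0.25$, let $W$ be the shortest prefix of sorted $Y_{j-1}$ with total size at least $0.25$ (or all of $Y_{j-1}$ if none exists), and if then $w_j>0.75p_j$ replace $W$ by $Y_{j-1}\setminus W$. Migrate the jobs of $W$ to $m_1$ and assign $j$ to $m_2$. -}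

module Defs where

open import Algebra.Bundles using (CommutativeRing)
open import Algebra.Structures using (IsCommutativeRing)
import Algebra.Construct.NaturalChoice.Max as Max
open import Data.Bool.Base using (if_then_else_; _∨_)
open import Data.Fin.Base using (Fin; zero; suc)
import Data.Fin.Properties as Fin
open import Data.List.Base
  using (List; []; filter; foldr; map; take; inits; head; last; allFin)
open import Data.List.Sort.Base using (SortingAlgorithm)
open import Data.Maybe.Base using (fromMaybe)
open import Data.Nat.Base using (ℕ; zero; suc)
open import Data.Product.Base using (_×_; Σ-syntax)
open import Data.Vec.Base using (Vec; []; _∷_; lookup)
open import Level using (0ℓ; _⊔_) renaming (suc to lsuc)
open import Relation.Binary.Bundles using (DecTotalOrder; TotalOrder)
import Relation.Binary.Construct.Flip.EqAndOrd as Flip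
import Relation.Binary.Construct.On as On
import Relation.Binary.Construct.NonStrictToStrict as ToStrict
open import Relation.Binary.Core using (Rel)
open import Relation.Binary.Definitions using (DecidableEquality)
open import Relation.Binary.Structures using (IsDecTotalOrder)
open import Relation.Binary.PropositionalEquality using (_≡_; refl)
open import Relation.Nullary using (¬_; does; yes; no; ¬?)

-- Sizes, loads and factors are taken from an arbitrary ordered field with
-- decidable order.  ℚ is such a field, and so, classically, is ℝ.
record OrderedField c ℓ₁ ℓ₂ : Set (lsuc (c ⊔ ℓ₁ ⊔ ℓ₂)) where
  infix  8 _⁻¹
  infix  8 -_
  infixl 7 _*_ _/_
  infixl 6 _+_
  infix  4 _≈_ _≤_
  field
    Carrier           : Set c
    _≈_               : Rel Carrier ℓ₁
    _≤_               : Rel Carrier ℓ₂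
    _+_ _*_           : Carrier → Carrier → Carrier
    -_                : Carrier → Carrier
    0# 1#             : Carrier
    -- The value of 0# ⁻¹ is irrelevant.
    _⁻¹               : Carrier → Carrier
    isCommutativeRing : IsCommutativeRing _≈_ _+_ _*_ -_ 0# 1#
    isDecTotalOrder   : IsDecTotalOrder _≈_ _≤_
    0≉1               : ¬ (0# ≈ 1#)
    *-inverseʳ        : ∀ x → ¬ (x ≈ 0#) → x * x ⁻¹ ≈ 1#
    +-monoˡ-≤         : ∀ z {x y} → x ≤ y → x + z ≤ y + z
    *-nonNeg          : ∀ {x y} → 0# ≤ x → 0# ≤ y → 0# ≤ x * y

  commutativeRing : CommutativeRing c ℓ₁
  commutativeRing = record { isCommutativeRing = isCommutativeRing }

  decTotalOrder : DecTotalOrder c ℓ₁ ℓ₂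
  decTotalOrder = record { isDecTotalOrder = isDecTotalOrder }

  open DecTotalOrder decTotalOrder public using (_≤?_; totalOrder)
  open ToStrict _≈_ _≤_ public using (_<_)
  open CommutativeRing commutativeRing public using (_-_)

  _/_ : Carrier → Carrier → Carrier
  x / y = x * y ⁻¹

data Machine : Set where
  m₁ m₂ : Machine

_≟ᴹ_ : DecidableEquality Machine
m₁ ≟ᴹ m₁ = yes refl
m₁ ≟ᴹ m₂ = no λ ()
m₂ ≟ᴹ m₁ = no λ ()
m₂ ≟ᴹ m₂ = yes refl

data GoS : Set where
  gos₁ gos₂ : GoS

_≟ᴳ_ : DecidableEquality GoS
gos₁ ≟ᴳ gos₁ = yes refl
gos₁ ≟ᴳ gos₂ = no λ ()
gos₂ ≟ᴳ gos₁ = no λ ()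
gos₂ ≟ᴳ gos₂ = yes refl

module BinStretching {c ℓ₁ ℓ₂} (F : OrderedField c ℓ₁ ℓ₂) where

  open OrderedField F
  open Max totalOrder using () renaming (_⊔_ to max)

  2# 3# 4# 5# ½ ¼ ¾ 5/4 : Carrier
  2#  = 1# + 1#
  3#  = 2# + 1#
  4#  = 3# + 1#
  5#  = 4# + 1#
  ½   = 1# / 2#
  ¼   = 1# / 4#
  ¾   = 3# / 4#
  5/4 = 5# / 4#

  record Job : Set (c ⊔ ℓ₁ ⊔ ℓ₂) where
    field
      size     : Carrier
      size-pos : 0# < size
      gos      : GoS

  open Job public

  -- The jobs in reverse order of arrival: in j ∷ js, the job j arrives right
  -- after the jobs js, and the job with index i in js has index suc i.
  Jobs : ℕ → Set (c ⊔ ℓ₁ ⊔ ℓ₂)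
  Jobs n = Vec Job n

  Schedule : ℕ → Set
  Schedule n = Fin n → Machine

  module _ {n} (js : Jobs n) where

    Feasible : Schedule n → Set
    Feasible σ = ∀ i → gos (lookup js i) ≡ gos₁ → σ i ≡ m₁

    total : List (Fin n) → Carrier
    total is = foldr _+_ 0# (map (λ i → size (lookup js i)) is)

    jobsOn : Schedule n → Machine → List (Fin n)
    jobsOn σ m = filter (λ i → σ i ≟ᴹ m) (allFin n)

    load : Schedule n → Machine → Carrier
    load σ m = total (jobsOn σ m)

    makespan : Schedule n → Carrier
    makespan σ = max (load σ m₁) (load σ m₂)

    IsOptimalMakespan : Carrier → Set (ℓ₁ ⊔ ℓ₂)
    IsOptimalMakespan opt =
      (Σ[ σ ∈ Schedule n ] Feasible σ × makespan σ ≈ opt) ×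
      (∀ σ → Feasible σ → opt ≤ makespan σ)

    bySize : TotalOrder 0ℓ ℓ₁ ℓ₂
    bySize = On.totalOrder (Flip.totalOrder totalOrder)
                           (λ (i : Fin n) → size (lookup js i))

  -- A deterministic algorithm gives, for every sequence of jobs that have
  -- arrived so far, the schedule it maintains at that moment.  The optimal
  -- makespan of the complete input is scaled to 1, hence not an argument.
  Algorithm : Set (c ⊔ ℓ₁ ⊔ ℓ₂)
  Algorithm = ∀ n → Jobs n → Schedule n

  RespectsGoS : Algorithm → Set (c ⊔ ℓ₁ ⊔ ℓ₂)
  RespectsGoS A = ∀ {n} (js : Jobs n) → Feasible js (A n js)

  migrated : ∀ {n} → Schedule n → Schedule (suc n) → List (Fin n)
  migrated {n} σ σ′ = filter (λ i → ¬? (σ i ≟ᴹ σ′ (suc i))) (allFin n)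

  HasMigrationFactor : Carrier → Algorithm → Set (c ⊔ ℓ₁ ⊔ ℓ₂)
  HasMigrationFactor M A = ∀ {n} (js : Jobs n) (j : Job) →
    total js (migrated (A n js) (A (suc n) (j ∷ js))) ≤ M * size j

  -- The inputs of the bin stretching problem are those with optimum 1.
  HasCompetitiveRatio≤ : Carrier → Algorithm → Set (c ⊔ ℓ₁ ⊔ ℓ₂)
  HasCompetitiveRatio≤ ρ A = ∀ {n} (js : Jobs n) opt →
    IsOptimalMakespan js opt → opt ≈ 1# → makespan js (A n js) ≤ ρ * opt

  -- A choice of how ties are broken when sorting by non-increasing size.
  Sorting : Set (c ⊔ ℓ₁ ⊔ ℓ₂)
  Sorting = ∀ {n} (js : Jobs n) → SortingAlgorithm (bySize js)

  data Decision (n : ℕ) : Set where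
    assign-m₁            : Decision n
    migrate_andAssign-m₂ : List (Fin n) → Decision n

  module _ {n : ℕ} where

    open import Data.List.Membership.DecPropositional (Fin._≟_ {n})
      using (_∈?_)

    _∖_ : List (Fin n) → List (Fin n) → List (Fin n)
    xs ∖ ys = filter (λ x → ¬? (x ∈? ys)) xs

    execute : Schedule n → Decision n → Schedule (suc n)
    execute σ assign-m₁                zero    = m₁
    execute σ assign-m₁                (suc i) = σ i
    execute σ (migrate W andAssign-m₂) zero    = m₂
    execute σ (migrate W andAssign-m₂) (suc i) =
      if does (i ∈? W) then m₁ else σ i

  module AlgorithmB (sorting : Sorting) where

    module Step {n} (js : Jobs n) (σ : Schedule n) (j : Job) where

      p : Carrier
      p = size j

      Y sortedY jmaxY : List (Fin n)
      Y       = jobsOn js σ m₂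
      sortedY = SortingAlgorithm.sort (sorting js) Y
      -- The singleton of a largest job of Y, or [] if Y is empty.
      jmaxY   = take 1 sortedY

      y pmaxY : Carrier
      y     = total js Y
      pmaxY = total js jmaxY

      -- inits lists the prefixes by increasing length, starting with [].
      longestPrefix≤ : Carrier → List (Fin n)
      longestPrefix≤ b =
        fromMaybe [] (last (filter (λ W → total js W ≤? b) (inits sortedY)))

      shortestPrefix≥ : Carrier → List (Fin n)
      shortestPrefix≥ b =
        fromMaybe Y (head (filter (λ W → b ≤? total js W) (inits sortedY)))

      step4 : Decision n
      step4 =
        if does ((y - total js W) + p ≤? 5/4)
          then migrate W andAssign-m₂
          else assign-m₁
        where
        W : List (Fin n)
        W = longestPrefix≤ (¾ * p)

      W₅ : List (Fin n)
      W₅ =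
        if does (½ * y ≤? pmaxY) then Y ∖ jmaxY
        else if does (¼ ≤? pmaxY) then jmaxY
        else if does (total js V ≤? ¾ * p) then V
        else Y ∖ V
        where
        V : List (Fin n)
        V = shortestPrefix≥ ¼

      step5 : Decision n
      step5 =
        if does (p + pmaxY ≤? 5/4)
          then migrate W₅ andAssign-m₂
          else assign-m₁

      decision : Decision n
      decision =
        if does (gos j ≟ᴳ gos₁) ∨ does (¾ ≤? y) then assign-m₁
        else if does (y + p ≤? 5/4) then migrate [] andAssign-m₂
        else if does (¾ ≤? p) then step4
        else step5

    algorithmB : Algorithm
    algorithmB zero    []       ()
    algorithmB (suc n) (j ∷ js) =
      execute σ (Step.decision js σ j)
      where
      σ : Schedule n
      σ = algorithmB n js

  open AlgorithmB public using (algorithmB)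

{-# OPTIONS --safe #-}

-- Every migration leaves m₂ with load at least ¾, after which all jobs go to
-- m₁ and the bound on m₁ follows from the total load being at most 2.  So let
-- no migration have happened, and compare with a schedule τ of loads at most 1.
-- Let c₁₂ be the size of the jobs that the algorithm has on m₁ and τ on m₂, and
-- c₂₁ that of the jobs in the opposite situation; the load of m₁ is at most
-- 1 + c₁₂ - c₂₁.  Only a rejected job p with τ(p) = m₂ increases c₁₂.  When p is
-- rejected, a prefix L of the sorted jobs on m₂ consists of jobs that do not fit
-- together with p, so τ has L on m₁; moreover p and L are both larger than ½
-- and p ≤ ¼ + L, hence c₁₂ ≤ ¼ + c₂₁.  As p > ½, there is no second such job.

module Submission where

open import Algebra.Bundles using (CommutativeRing)
import Algebra.Construct.NaturalChoice.Max as Max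
import Algebra.Properties.Ring as RingProperties
import Algebra.Solver.Ring.NaturalCoefficients.Default as Solver
open import Data.Bool.Base using (true; false; if_then_else_; _∧_)
open import Data.Fin.Base using (Fin; zero; suc)
import Data.Fin.Properties as Fin
open import Data.List.Base
  using (List; []; _∷_; _++_; [_]; map; filter; take; drop; inits; head; last; allFin; tabulate)
open import Data.List.Membership.Propositional using (_∈_; _∉_)
open import Data.List.Membership.Propositional.Properties
  using (∈-allFin; ∈-filter⁺; ∈-filter⁻; ∈-++⁺ʳ)
open import Data.List.Properties
  using (++-assoc; ++-identityʳ; filter-++; filter-all; filter-none; filter-≐;
         head-map; last-map; map-tabulate; take++drop≡id)
open import Data.List.Relation.Binary.Permutation.Propositional
  using (_↭_; ↭-sym; ↭⇒↭ₛ; ↭⇒↭ₛ′)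
open import Data.List.Relation.Binary.Permutation.Propositional.Properties
  using (map⁺; filter-↭)
import Data.List.Relation.Binary.Permutation.Setoid.Properties as Permutation
open import Data.List.Relation.Unary.All as All using (All; []; _∷_)
import Data.List.Relation.Unary.All.Properties as All
open import Data.List.Relation.Unary.AllPairs using (AllPairs; _∷_)
open import Data.List.Relation.Unary.Any using (here; there)
open import Data.List.Relation.Unary.Sorted.TotalOrder.Properties using (Sorted⇒AllPairs)
open import Data.List.Relation.Unary.Unique.Propositional using (Unique)
import Data.List.Relation.Unary.Unique.Propositional.Properties as Unique
import Data.List.Sort as Sort
open import Data.List.Sort.Base using (SortingAlgorithm)
open import Data.Maybe.Base as Maybe using (Maybe; just; nothing; fromMaybe; _<∣>_)
open import Data.Maybe.Properties using (<∣>-identityʳ)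
open import Data.Nat.Base using (zero; suc)
open import Data.Product using (_×_; Σ-syntax; ∃-syntax; _,_; proj₁; proj₂)
open import Data.Sum as Sum using (inj₁; inj₂)
open import Data.Vec.Base using ([]; _∷_; lookup)
open import Defs
open import Function.Base using (_∘_)
open import Level using (_⊔_)
open import Relation.Binary.Bundles using (DecTotalOrder; Setoid)
import Relation.Binary.Construct.Flip.EqAndOrd as Flip
import Relation.Binary.Construct.On as On
import Relation.Binary.Properties.TotalOrder as TotalOrderProperties
open import Relation.Binary.PropositionalEquality as ≡ using (_≡_; _≢_; cong; subst)
open import Relation.Nullary
  using (¬_; Dec; does; yes; no; ¬?; contradiction; _⊎-dec_)
open import Relation.Nullary.Decidable using (decidable-stable)
open import Relation.Unary using (Pred; Decidable)

-- Arithmetic and order in an ordered field.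

module OrderedFieldProperties {c ℓ₁ ℓ₂} (F : OrderedField c ℓ₁ ℓ₂) where

  open OrderedField F
  open BinStretching F
  open CommutativeRing commutativeRing public
    using (refl; sym; trans; setoid; ring; commutativeSemiring;
           +-congˡ; +-congʳ; +-assoc; +-comm; +-identityˡ; +-identityʳ;
           -‿inverseˡ; -‿inverseʳ; *-identityˡ; *-identityʳ; *-assoc;
           *-congʳ; *-congˡ; +-isCommutativeMonoid)
    renaming (reflexive to ≡⇒≈)
  open DecTotalOrder decTotalOrder public
    using (reflexive; ≤-respˡ-≈; ≤-respʳ-≈)
    renaming (refl to ≤-refl; trans to ≤-trans; total to ≤-total)
  open TotalOrderProperties totalOrder public using (≰⇒>; <⇒≱; <-respʳ-≈)
  open RingProperties ring using (-1*x≈-x; -‿involutive)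
  open Solver commutativeSemiring public using (solve; con; _:+_; _:*_; _:=_)

  ≤-<-trans : ∀ {x y z} → x ≤ y → y < z → x < z
  ≤-<-trans x≤y y<z = ≰⇒> λ z≤x → <⇒≱ y<z (≤-trans z≤x x≤y)

  <-≤-trans : ∀ {x y z} → x < y → y ≤ z → x < z
  <-≤-trans x<y y≤z = ≰⇒> λ z≤x → <⇒≱ x<y (≤-trans y≤z z≤x)

  infixl 6 _+≤_ _+<_

  +-monoʳ-≤ : ∀ z {x y} → x ≤ y → z + x ≤ z + y
  +-monoʳ-≤ z x≤y = ≤-respˡ-≈ (+-comm _ z) (≤-respʳ-≈ (+-comm _ z) (+-monoˡ-≤ z x≤y))

  _+≤_ : ∀ {x y u v} → x ≤ y → u ≤ v → x + u ≤ y + v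
  _+≤_ {y = y} {u} x≤y u≤v = ≤-trans (+-monoˡ-≤ u x≤y) (+-monoʳ-≤ y u≤v)

  x+y-y≈x : ∀ x y → (x + y) - y ≈ x
  x+y-y≈x x y = trans (+-assoc x y (- y)) (trans (+-congˡ (-‿inverseʳ y)) (+-identityʳ x))

  +-cancelʳ-≤ : ∀ z {x y} → x + z ≤ y + z → x ≤ y
  +-cancelʳ-≤ z {x} {y} le =
    ≤-respˡ-≈ (x+y-y≈x x z) (≤-respʳ-≈ (x+y-y≈x y z) (+-monoˡ-≤ (- z) le))

  -- Strictness comes from the left operand alone. As the operator associates to the left, a chain
  -- is strict once its first link is, and the other links only need `≤`.
  _+<_ : ∀ {x y u v} → x < y → u ≤ v → x + u < y + v
  _+<_ {u = u} x<y u≤v = ≰⇒> λ y+v≤x+u →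
    <⇒≱ x<y (+-cancelʳ-≤ u (≤-trans (+-monoʳ-≤ _ u≤v) y+v≤x+u))

  -- Derives x ≤ y from a sum a ≤ b of known inequalities.  In the side condition
  -- all terms are moved so that no subtraction occurs; it is then a semiring
  -- identity, which the solver over ℕ decides.
  linear : ∀ {a b x y} → a ≤ b → x + b ≈ y + a → x ≤ y
  linear {a} {b} {x} {y} a≤b eq =
    +-cancelʳ-≤ b (≤-respˡ-≈ (sym eq) (+-monoʳ-≤ y a≤b))

  linear< : ∀ {a b x y} → a < b → x + b ≈ y + a → x < y
  linear< {a} {b} {x} {y} a<b eq = ≰⇒> λ y≤x →
    <⇒≱ a<b (linear y≤x (trans (+-comm b x) (trans eq (+-comm y a))))

  -- Totality replaces division by two: if `y ≤ x`, adding this to the hypothesis and cancelling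
  -- gives `x ≤ y`.
  halve : ∀ {x y} → x + x ≤ y + y → x ≤ y
  halve {x} {y} le with ≤-total x y
  ... | inj₁ x≤y = x≤y
  ... | inj₂ y≤x = linear (le +≤ y≤x)
    (solve 2 (λ x y → x :+ (y :+ y :+ x) := y :+ (x :+ x :+ y)) refl x y)

  halve< : ∀ {x y} → x + x < y + y → x < y
  halve< lt = ≰⇒> λ y≤x → <⇒≱ lt (y≤x +≤ y≤x)

  0≤1 : 0# ≤ 1#
  0≤1 with ≤-total 0# 1#
  ... | inj₁ 0≤1 = 0≤1
  -- Here `- 1#` is nonnegative, and `1#` is its square.
  ... | inj₂ 1≤0 = ≤-respʳ-≈
    (trans (-1*x≈-x (- 1#)) (-‿involutive 1#)) (*-nonNeg 0≤-1 0≤-1)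
    where
    0≤-1 : 0# ≤ - 1#
    0≤-1 = ≤-respˡ-≈ (-‿inverseʳ 1#) (≤-respʳ-≈ (+-identityˡ _) (+-monoˡ-≤ (- 1#) 1≤0))

  0<1 : 0# < 1#
  0<1 = 0≤1 , 0≉1

  positive-suc : ∀ {x} → 0# < x → 0# < x + 1#
  positive-suc 0<x = linear< (0<x +< 0≤1)
    (solve 1 (λ x → con 0 :+ (x :+ con 1) := x :+ con 1 :+ (con 0 :+ con 0)) refl _)

  0<2 : 0# < 2#
  0<2 = positive-suc 0<1

  0<4 : 0# < 4#
  0<4 = positive-suc (positive-suc 0<2)

  -- The solver sees 4# ⁻¹ as a variable k, in which ¼, ¾ and 5/4 are, by
  -- computation, con 1 :* k, con 3 :* k and con 5 :* k.  The relation 4 k ≈ 1 is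
  -- supplied by adding instances of quarters to the sum of inequalities.
  quarters : ∀ x → x ≈ 4# * (4# ⁻¹ * x)
  quarters x = sym (trans (sym (*-assoc _ _ x))
    (trans (*-congʳ (*-inverseʳ 4# λ 4≈0 → proj₂ 0<4 (sym 4≈0))) (*-identityˡ x)))

  halves : ∀ x → x ≈ 2# * (½ * x)
  halves x = sym (trans (solve 2 (λ h x → con 2 :* (con 1 :* h :* x) := con 2 :* h :* x) refl _ x)
    (trans (*-congʳ (*-inverseʳ 2# λ 2≈0 → proj₂ 0<2 (sym 2≈0))) (*-identityˡ x)))

  quarter : ∀ {x y} → 4# * x ≤ 4# * y → x ≤ y
  quarter {x} {y} le = halve (halve (≤-respˡ-≈ (lemma x) (≤-respʳ-≈ (lemma y) le)))
    where
    lemma : ∀ x → 4# * x ≈ (x + x) + (x + x)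
    lemma = solve 1 (λ x → con 4 :* x := x :+ x :+ (x :+ x)) refl

  0≤¼ : 0# ≤ ¼
  0≤¼ = quarter (linear (0≤1 +≤ reflexive (quarters 1#))
    (solve 1 (λ k → con 4 :* con 0 :+ (con 1 :+ con 4 :* (k :* con 1))
                 := con 4 :* (con 1 :* k) :+ (con 0 :+ con 1)) refl (4# ⁻¹)))

  0<¼ : 0# < ¼
  0<¼ = ≰⇒> λ ¼≤0 → <⇒≱ 0<1 (linear (¼≤0 +≤ ¼≤0 +≤ ¼≤0 +≤ ¼≤0 +≤ reflexive (quarters 1#))
    (solve 1 (λ k → con 1 :+ (con 0 :+ con 0 :+ con 0 :+ con 0 :+ con 4 :* (k :* con 1))
                 := con 0 :+ (con 1 :* k :+ con 1 :* k :+ con 1 :* k :+ con 1 :* k :+ con 1)) refl (4# ⁻¹)))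

  *-monoˡ-≤ : ∀ {x y z} → 0# ≤ z → x ≤ y → x * z ≤ y * z
  *-monoˡ-≤ {x} {y} {z} 0≤z x≤y = linear (*-nonNeg 0≤z 0≤y-x) (trans
    (solve 3 (λ x z d → x :* z :+ z :* d := (x :+ d) :* z) refl x z (y - x))
    (trans (*-congʳ x+[y-x]≈y) (sym (+-identityʳ _))))
    where
    x+[y-x]≈y : x + (y - x) ≈ y
    x+[y-x]≈y = trans (+-comm x (y - x))
      (trans (+-assoc y (- x) x) (trans (+-congˡ (-‿inverseˡ x)) (+-identityʳ y)))
    0≤y-x : 0# ≤ y - x
    0≤y-x = ≤-respˡ-≈ (-‿inverseʳ x) (+-monoˡ-≤ (- x) x≤y)

  0≤5/4 : 0# ≤ 5/4
  0≤5/4 = linear (0≤¼ +≤ 0≤¼ +≤ 0≤¼ +≤ 0≤¼ +≤ 0≤¼)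
    (solve 1 (λ k → con 0 :+ (con 1 :* k :+ con 1 :* k :+ con 1 :* k :+ con 1 :* k :+ con 1 :* k)
                 := con 5 :* k :+ (con 0 :+ con 0 :+ con 0 :+ con 0 :+ con 0)) refl (4# ⁻¹))

  0≤¾ : 0# ≤ ¾
  0≤¾ = linear (0≤¼ +≤ 0≤¼ +≤ 0≤¼)
    (solve 1 (λ k → con 0 :+ (con 1 :* k :+ con 1 :* k :+ con 1 :* k)
                 := con 3 :* k :+ (con 0 :+ con 0 :+ con 0)) refl (4# ⁻¹))

  -- Numerical inequalities behind the decisions of the algorithm.

  half<job : ∀ {p y} → y < ¾ → 5/4 < y + p → ¼ + ¼ < p
  half<job {p} {y} y<¾ big = linear< (y<¾ +< proj₁ big)
    (solve 3 (λ k p y → con 1 :* k :+ con 1 :* k :+ (con 3 :* k :+ (y :+ p))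
                     := p :+ (y :+ con 5 :* k)) refl (4# ⁻¹) p y)

  -- Twice the migration budget exceeds every load below `¾`, so the smaller of two parts of such a
  -- load may always migrate.
  ¾-size-doubled : ∀ {p} → ¼ + ¼ < p → ¾ < ¾ * p + ¾ * p
  ¾-size-doubled {p} ½<p = linear< (lt +< proj₁ lt +< proj₁ lt)
    (solve 2 (λ k p → con 3 :* k :+ (k :* p :+ k :* p :+ (k :* p :+ k :* p) :+ (k :* p :+ k :* p))
                   := con 3 :* k :* p :+ con 3 :* k :* p :+ (k :+ k :+ k)) refl (4# ⁻¹) p)
    where
    lt : 4# ⁻¹ < 4# ⁻¹ * p + 4# ⁻¹ * p
    lt = halve< (linear< (½<p +< reflexive (quarters p))
      (solve 2 (λ k p → k :+ k :+ (p :+ con 4 :* (k :* p))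
                     := k :* p :+ k :* p :+ (k :* p :+ k :* p) :+ (con 1 :* k :+ con 1 :* k :+ p))
        refl (4# ⁻¹) p))

  below-half : ∀ {y m} → ½ * y ≤ m → y ≤ m + m
  below-half {y} {m} le = linear (le +≤ le +≤ reflexive (halves y))
    (solve 3 (λ h y m → y :+ (m :+ m :+ con 2 :* (con 1 :* h :* y))
                     := m :+ m :+ (con 1 :* h :* y :+ con 1 :* h :* y :+ y)) refl (2# ⁻¹) y m)

  above-half : ∀ {y m} → m < ½ * y → m + m < y
  above-half {y} {m} lt = linear< (lt +< proj₁ lt +< reflexive (sym (halves y)))
    (solve 3 (λ h y m → m :+ m :+ (con 1 :* h :* y :+ con 1 :* h :* y :+ y)
                     := y :+ (m :+ m :+ con 2 :* (con 1 :* h :* y))) refl (2# ⁻¹) y m)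

  -- p, y: size of the arriving job and load of m₂ before it; w, z: the parts
  -- of y that move to m₁ and that remain.
  module _ {p y : Carrier} (p<¾ : p < ¾) (y<¾ : y < ¾) (y+p>5/4 : 5/4 < y + p) where

    private
      ½<p : ¼ + ¼ < p
      ½<p = half<job y<¾ y+p>5/4

      y<2¾p : y < ¾ * p + ¾ * p
      y<2¾p = linear< (y<¾ +< proj₁ (¾-size-doubled ½<p))
        (solve 3 (λ k p y → y :+ (con 3 :* k :+ (con 3 :* k :* p :+ con 3 :* k :* p))
                         := con 3 :* k :* p :+ con 3 :* k :* p :+ (y :+ con 3 :* k)) refl (4# ⁻¹) p y)

    module _ {w z : Carrier} (w+z≈y : w + z ≈ y) where

      small-migration : w ≤ ¾ * p → y ≤ z + ¾ * p
      small-migration w≤¾p = linear (reflexive (sym w+z≈y) +≤ w≤¾p)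
        (solve 4 (λ q w z y → y :+ (w :+ z :+ q) := z :+ q :+ (y :+ w)) refl (¾ * p) w z y)

      -- Both `y` and `p` are below `¾`, so their sum exceeds `5/4` by less than `¼`.
      remaining-small : ¼ ≤ w → z + p ≤ 5/4
      remaining-small ¼≤w = linear (reflexive w+z≈y +≤ proj₁ y<¾ +≤ ¼≤w +≤ proj₁ p<¾)
        (solve 5 (λ k w z y p → z :+ p :+ (y :+ con 3 :* k :+ w :+ con 3 :* k)
                             := con 5 :* k :+ (w :+ z :+ y :+ con 1 :* k :+ p)) refl (4# ⁻¹) w z y p)

      remaining-large : w < ¼ + ¼ → ¾ ≤ z + p
      remaining-large w<½ = linear (reflexive (sym w+z≈y) +≤ proj₁ y+p>5/4 +≤ proj₁ w<½)
        (solve 5 (λ k w z y p → con 3 :* k :+ (w :+ z :+ (y :+ p) :+ (con 1 :* k :+ con 1 :* k))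
                             := z :+ p :+ (y :+ con 5 :* k :+ w)) refl (4# ⁻¹) w z y p)

      half-migration : w + w ≤ y → y ≤ z + ¾ * p
      half-migration 2w≤y = halve (linear
        (reflexive (sym w+z≈y) +≤ reflexive (sym w+z≈y) +≤ 2w≤y +≤ proj₁ y<2¾p)
        (solve 4 (λ q w z y → y :+ y :+ (w :+ z :+ (w :+ z) :+ y :+ (q :+ q))
                           := z :+ q :+ (z :+ q) :+ (y :+ y :+ (w :+ w) :+ y)) refl (¾ * p) w z y))

      -- At least half of `y` stays, so twice `z + p` is at least `(y + p) + p`, which exceeds
      -- `5/4 + ½` and hence twice `¾`.
      half-remaining : w + w ≤ y → ¾ ≤ z + p
      half-remaining 2w≤y = halve (linear
        (reflexive (sym w+z≈y) +≤ reflexive (sym w+z≈y) +≤ 2w≤y +≤ proj₁ y+p>5/4 +≤ proj₁ ½<p +≤ 0≤¼)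
        (solve 5 (λ k w z y p →
          con 3 :* k :+ con 3 :* k :+
            (w :+ z :+ (w :+ z) :+ y :+ (y :+ p) :+ p :+ con 1 :* k)
          := z :+ p :+ (z :+ p) :+
            (y :+ y :+ (w :+ w) :+ con 5 :* k :+ (con 1 :* k :+ con 1 :* k) :+ con 0))
          refl (4# ⁻¹) w z y p))

    -- The kept part exceeds one budget while `y` is below two, so less than one budget moves.
    kept-prefix-migration : ∀ {z} → ¾ * p < z → y ≤ z + ¾ * p
    kept-prefix-migration {z} ¾p<z = linear (proj₁ y<2¾p +≤ proj₁ ¾p<z)
      (solve 3 (λ q z y → y :+ (q :+ q :+ z) := z :+ q :+ (y :+ q)) refl (¾ * p) z y)

    kept-prefix-large : ∀ {z} → ¼ ≤ z → ¾ ≤ z + p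
    kept-prefix-large {z} ¼≤z = linear (¼≤z +≤ proj₁ ½<p)
      (solve 3 (λ k z p → con 3 :* k :+ (z :+ p)
                       := z :+ p :+ (con 1 :* k :+ (con 1 :* k :+ con 1 :* k))) refl (4# ⁻¹) z p)

    kept-prefix-small : ∀ {z} → z < ¼ + ¼ → z + p ≤ 5/4
    kept-prefix-small {z} z<½ = linear (proj₁ z<½ +≤ proj₁ p<¾)
      (solve 3 (λ k z p → z :+ p :+ (con 1 :* k :+ con 1 :* k :+ con 3 :* k)
                       := con 5 :* k :+ (z :+ p)) refl (4# ⁻¹) z p)

  exceeds-one : ∀ {x} → 5/4 < x → 1# < x
  exceeds-one {x} big = linear< (big +< reflexive (quarters 1#) +< 0≤¼)
    (solve 2 (λ k x → con 1 :+ (x :+ con 4 :* (k :* con 1) :+ con 1 :* k)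
                   := x :+ (con 5 :* k :+ con 1 :+ con 0)) refl (4# ⁻¹) x)

  rejected-small : ∀ {p m} → p < ¾ → ¼ + ¼ < m → p ≤ ¼ + m
  rejected-small {p} {m} p<¾ ½<m = linear (proj₁ p<¾ +≤ proj₁ ½<m)
    (solve 3 (λ k p m → p :+ (con 3 :* k :+ m)
                     := con 1 :* k :+ m :+ (p :+ (con 1 :* k :+ con 1 :* k))) refl (4# ⁻¹) p m)

  -- p: size of a job handled in step 4; t: total size of W and of the next job in
  -- sorted order, which has size s; w, z, y: as above.
  module _ {p : Carrier} (¾≤p : ¾ ≤ p) where

    private
      ½≤¾p : ¼ + ¼ ≤ ¾ * p
      ½≤¾p = quarter (linear
        (¾≤p +≤ ¾≤p +≤ ¾≤p +≤ reflexive (quarters p) +≤ reflexive (quarters p)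
          +≤ reflexive (quarters p) +≤ 0≤¼)
        (solve 2 (λ k p →
          con 4 :* (con 1 :* k :+ con 1 :* k) :+
            (p :+ p :+ p :+ con 4 :* (k :* p) :+ con 4 :* (k :* p) :+ con 4 :* (k :* p)
              :+ con 1 :* k)
          := con 4 :* (con 3 :* k :* p) :+
            (con 3 :* k :+ con 3 :* k :+ con 3 :* k :+ p :+ p :+ p :+ con 0)) refl (4# ⁻¹) p))

    -- If `W` exhausted the jobs on `m₂`, then `p` alone would exceed `5/4`.
    nothing-remains : ∀ {z} → p ≤ 1# → z ≈ 0# → ¬ 5/4 < z + p
    nothing-remains {z} p≤1 z≈0 big = <⇒≱ (exceeds-one big)
      (linear (p≤1 +≤ reflexive z≈0) (solve 2 (λ p z → z :+ p :+ (con 1 :+ con 0)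
                                                    := con 1 :+ (p :+ z)) refl p z))

    module _ {t : Carrier} (¾p<t : ¾ * p < t) where

      prefix-large : ¼ + ¼ < t
      prefix-large = linear< (¾p<t +< ½≤¾p)
        (solve 3 (λ h q t → h :+ (t :+ q) := t :+ (q :+ h)) refl (¼ + ¼) (¾ * p) t)

      -- Split `p` into a quarter and three quarters of itself: the former is at most `¼`, the
      -- latter is below `t`.
      prefix-compensates : p ≤ 1# → p ≤ ¼ + t
      prefix-compensates p≤1 = linear (¼p≤¼ +≤ proj₁ ¾p<t +≤ reflexive (quarters p))
        (solve 3 (λ k p t → p :+ (con 1 :* k :+ t :+ con 4 :* (k :* p))
                         := con 1 :* k :+ t :+ (k :* p :+ con 3 :* k :* p :+ p)) refl (4# ⁻¹) p t)
        where
        ¼p≤¼ : 4# ⁻¹ * p ≤ ¼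
        ¼p≤¼ = quarter (linear (p≤1 +≤ reflexive (quarters 1#) +≤ reflexive (sym (quarters p)))
          (solve 2 (λ k p → con 4 :* (k :* p) :+ (con 1 :+ con 4 :* (k :* con 1) :+ p)
                         := con 4 :* (con 1 :* k) :+ (p :+ con 1 :+ con 4 :* (k :* p))) refl (4# ⁻¹) p))

      -- From `z = y - w` and `s = t - w` follows `p + s = (z + p) - y + t`. Here `(z + p) - y`
      -- exceeds `5/4 - ¾ = ½`, and `t > ¾ * p ≥ ½`.
      prefix-incompatible : ∀ {w z y s} → w + z ≈ y → y < ¾ → 5/4 < z + p → t ≈ w + s → 1# < p + s
      prefix-incompatible {w} {z} {y} {s} w+z≈y y<¾ big t≈w+s = linear<
        (¾p<t +< reflexive (quarters 1#) +< reflexive w+z≈y +< proj₁ y<¾ +< proj₁ big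
          +< reflexive t≈w+s +< ½≤¾p)
        (solve 7 (λ k p t w z y s →
          con 1 :+ (t :+ con 4 :* (k :* con 1) :+ y :+ con 3 :* k :+ (z :+ p)
            :+ (w :+ s) :+ con 3 :* k :* p)
          := p :+ s :+ (con 3 :* k :* p :+ con 1 :+ (w :+ z) :+ y :+ con 5 :* k
            :+ t :+ (con 1 :* k :+ con 1 :* k)))
          refl (4# ⁻¹) p t w z y s)

  two-large : ∀ {x y} → ¼ + ¼ < x → ¼ + ¼ < y → ¬ x + y ≤ 1#
  two-large {x} {y} ½<x ½<y = <⇒≱ (linear< (½<x +< proj₁ ½<y +< reflexive (quarters 1#))
    (solve 3 (λ k x y → con 1 :+ (x :+ y :+ con 4 :* (k :* con 1))
                     := x :+ y :+ (con 1 :* k :+ con 1 :* k :+ (con 1 :* k :+ con 1 :* k) :+ con 1))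
      refl (4# ⁻¹) x y))

  -- The total size is at most 2, and `m₂` already takes `¾` of it.
  load-within-two : ∀ {x y a b} → x + y ≈ a + b → a ≤ 1# → b ≤ 1# → ¾ ≤ y → x ≤ 5/4
  load-within-two {x} {y} {a} {b} eq a≤1 b≤1 ¾≤y = linear
    (reflexive eq +≤ a≤1 +≤ b≤1 +≤ ¾≤y +≤ reflexive (quarters 1#) +≤ reflexive (quarters 1#))
    (solve 5 (λ k x y a b →
      x :+ (a :+ b :+ con 1 :+ con 1 :+ y :+ con 4 :* (k :* con 1) :+ con 4 :* (k :* con 1))
      := con 5 :* k :+ (x :+ y :+ a :+ b :+ con 3 :* k :+ con 1 :+ con 1)) refl (4# ⁻¹) x y a b)

  balanced-load : ∀ {a b d} → a + d ≤ 1# → b ≤ ¼ + d → a + b ≤ 5/4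
  balanced-load {a} {b} {d} a+d≤1 b≤¼+d = linear (a+d≤1 +≤ b≤¼+d +≤ reflexive (quarters 1#))
    (solve 4 (λ k a b d → a :+ b :+ (con 1 :+ (con 1 :* k :+ d) :+ con 4 :* (k :* con 1))
                       := con 5 :* k :+ (a :+ d :+ b :+ con 1)) refl (4# ⁻¹) a b d)

-- Conditionals, filtered lists and extremal prefixes.

if-dec : ∀ {a p q} {A : Set a} {P : Set p} (C : A → Set q) (P? : Dec P) {x y : A} →
  (P → C x) → (¬ P → C y) → C (if does P? then x else y)
if-dec C (yes p) t e = t p
if-dec C (no ¬p) t e = e ¬p

module _ {a p q} {A : Set a} {P : Pred A p} {Q : Pred A q} (P? : Decidable P) (Q? : Decidable Q) where

  filter-comm : ∀ xs → filter P? (filter Q? xs) ≡ filter Q? (filter P? xs)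
  filter-comm [] = ≡.refl
  filter-comm (x ∷ xs) with P? x in Px | Q? x in Qx
  ... | yes _ | yes _ rewrite Px | Qx = cong (x ∷_) (filter-comm xs)
  ... | yes _ | no _  rewrite Qx = filter-comm xs
  ... | no _  | yes _ rewrite Px = filter-comm xs
  ... | no _  | no _  = filter-comm xs

  filter-∧ : ∀ {r} {R : Pred A r} (R? : Decidable R) →
    (∀ x → does (R? x) ≡ does (Q? x) ∧ does (P? x)) →
    ∀ xs → filter R? xs ≡ filter P? (filter Q? xs)
  filter-∧ R? eq [] = ≡.refl
  filter-∧ R? eq (x ∷ xs) rewrite eq x with Q? x | filter-∧ R? eq xs
  ... | no _  | ih = ih
  ... | yes _ | ih with does (P? x)
  ...   | true  = cong (x ∷_) ih
  ...   | false = ih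

  filter-cong-∈ : ∀ xs → (∀ {x} → x ∈ xs → P x → Q x) → (∀ {x} → x ∈ xs → Q x → P x) →
    filter P? xs ≡ filter Q? xs
  filter-cong-∈ [] to from = ≡.refl
  filter-cong-∈ (x ∷ xs) to from with filter-cong-∈ xs (to ∘ there) (from ∘ there)
  ... | ih with P? x | Q? x
  ...   | yes _  | yes _  = cong (x ∷_) ih
  ...   | yes px | no ¬qx = contradiction (to (here ≡.refl) px) ¬qx
  ...   | no ¬px | yes qx = contradiction (from (here ≡.refl) qx) ¬px
  ...   | no _   | no _   = ih

filter-map : ∀ {a b p} {A : Set a} {B : Set b} {P : Pred B p} (P? : Decidable P) (f : A → B) xs →
  filter P? (map f xs) ≡ map f (filter (P? ∘ f) xs)
filter-map P? f [] = ≡.refl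
filter-map P? f (x ∷ xs) with does (P? (f x))
... | true  = cong (f x ∷_) (filter-map P? f xs)
... | false = filter-map P? f xs

last-∷ : ∀ {a} {A : Set a} (x : A) xs → last (x ∷ xs) ≡ (last xs <∣> just x)
last-∷ x []           = ≡.refl
last-∷ x (_ ∷ [])     = ≡.refl
last-∷ x (_ ∷ z ∷ xs) = last-∷ x (z ∷ xs)

module _ {a} {A : Set a} where

  -- Maximality is recorded as failure of `P` after one more element; the rest `Z` is kept to name
  -- that element.
  data LastPrefix {p} (P : Pred (List A) p) (xs : List A) : Maybe (List A) → Set (a ⊔ p) where
    none : ¬ P [] → LastPrefix P xs nothing
    some : ∀ {W} Z → W ++ Z ≡ xs → P W → (∀ {z Z′} → Z ≡ z ∷ Z′ → ¬ P (W ++ [ z ])) →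
      LastPrefix P xs (just W)

  -- The nonempty prefixes of `x ∷ xs` are those of `xs` behind `x`, so the recursion runs with
  -- `P ∘ (x ∷_)`. The empty prefix comes first in `inits` and is thus only the fallback of `<∣>`.
  lastPrefix : ∀ {p} {P : Pred (List A) p} (P? : Decidable P) xs →
    LastPrefix P xs (last (filter P? (inits xs)))
  lastPrefix P? [] with P? []
  ... | yes P[] = some [] ≡.refl P[] λ ()
  ... | no ¬P[] = none ¬P[]
  lastPrefix {P = P} P? (x ∷ xs) =
    subst (LastPrefix P (x ∷ xs)) (≡.sym unfold) (extend (lastPrefix (P? ∘ (x ∷_)) xs))
    where
    Ws : List (List A)
    Ws = filter P? (map (x ∷_) (inits xs))

    last-Ws : last Ws ≡ Maybe.map (x ∷_) (last (filter (P? ∘ (x ∷_)) (inits xs)))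
    last-Ws = ≡.trans (cong last (filter-map P? (x ∷_) (inits xs)))
      (last-map (x ∷_) (filter (P? ∘ (x ∷_)) (inits xs)))

    unfold : last (filter P? (inits (x ∷ xs))) ≡
      (Maybe.map (x ∷_) (last (filter (P? ∘ (x ∷_)) (inits xs))) <∣> last (filter P? [ [] ]))
    unfold with P? []
    ... | yes _ = ≡.trans (last-∷ [] Ws) (cong (_<∣> just []) last-Ws)
    ... | no _  = ≡.trans last-Ws (≡.sym (<∣>-identityʳ _))

    extend : ∀ {m} → LastPrefix (P ∘ (x ∷_)) xs m →
      LastPrefix P (x ∷ xs) (Maybe.map (x ∷_) m <∣> last (filter P? [ [] ]))
    extend (some Z eq PW max) = some Z (cong (x ∷_) eq) PW max
    extend (none ¬P[x]) with P? []
    ... | yes P[] = some (x ∷ xs) ≡.refl P[] λ { ≡.refl → ¬P[x] }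
    ... | no ¬P[] = none ¬P[]

  -- Minimality means that `P` fails without the last element `z`, which `some` therefore exposes;
  -- the empty prefix has no such element.
  data FirstPrefix {p} (P : Pred (List A) p) (xs : List A) : Maybe (List A) → Set (a ⊔ p) where
    none  : ¬ P xs → FirstPrefix P xs nothing
    empty : P [] → FirstPrefix P xs (just [])
    some  : ∀ W z Z → W ++ z ∷ Z ≡ xs → ¬ P W → P (W ++ [ z ]) →
      FirstPrefix P xs (just (W ++ [ z ]))

  firstPrefix : ∀ {p} {P : Pred (List A) p} (P? : Decidable P) xs →
    FirstPrefix P xs (head (filter P? (inits xs)))
  firstPrefix P? [] with P? []
  ... | yes P[] = empty P[]
  ... | no ¬P[] = none ¬P[]
  firstPrefix {P = P} P? (x ∷ xs) with P? []
  ... | yes P[] = empty P[]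
  ... | no ¬P[] =
    subst (FirstPrefix P (x ∷ xs)) (≡.sym unfold) (extend (firstPrefix (P? ∘ (x ∷_)) xs))
    where
    unfold : head (filter P? (map (x ∷_) (inits xs))) ≡
      Maybe.map (x ∷_) (head (filter (P? ∘ (x ∷_)) (inits xs)))
    unfold = ≡.trans (cong head (filter-map P? (x ∷_) (inits xs)))
      (head-map (filter (P? ∘ (x ∷_)) (inits xs)))

    extend : ∀ {m} → FirstPrefix (P ∘ (x ∷_)) xs m →
      FirstPrefix P (x ∷ xs) (Maybe.map (x ∷_) m)
    extend (none ¬Pxs)             = none ¬Pxs
    extend (empty P[x])            = some [] x xs ≡.refl ¬P[] P[x]
    extend (some W z Z eq ¬PW PWz) = some (x ∷ W) z Z (cong (x ∷_) eq) ¬PW PWz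

-- Serves for two relations: distinctness makes a prefix disjoint from the rest, and the order makes
-- its jobs at least as large as those of the rest.
AllPairs-++⁻ : ∀ {a r} {A : Set a} {R : A → A → Set r} xs {ys} → AllPairs R (xs ++ ys) →
  All (λ x → All (R x) ys) xs
AllPairs-++⁻ []       _            = []
AllPairs-++⁻ (x ∷ xs) (Rx ∷ pairs) = All.++⁻ʳ xs Rx ∷ AllPairs-++⁻ xs pairs

-- Total sizes, loads, and the joint table of two schedules.

module TotalProperties {c ℓ₁ ℓ₂} (F : OrderedField c ℓ₁ ℓ₂) where

  open OrderedField F
  open BinStretching F
  open OrderedFieldProperties F

  module _ {n} (js : Jobs n) where

    ≡⇒total≈ : ∀ {xs ys} → xs ≡ ys → total js xs ≈ total js ys
    ≡⇒total≈ xs≡ys = ≡⇒≈ (cong (total js) xs≡ys)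

    total-++ : ∀ xs ys → total js (xs ++ ys) ≈ total js xs + total js ys
    total-++ []       ys = sym (+-identityˡ _)
    total-++ (x ∷ xs) ys = trans (+-congˡ (total-++ xs ys)) (sym (+-assoc _ _ _))

    total-↭ : ∀ {xs ys} → xs ↭ ys → total js xs ≈ total js ys
    total-↭ xs↭ys = Permutation.foldr-commMonoid setoid +-isCommutativeMonoid
      (↭⇒↭ₛ′ (Setoid.isEquivalence setoid) (map⁺ (λ i → size (lookup js i)) xs↭ys))

    total-nonNeg : ∀ xs → 0# ≤ total js xs
    total-nonNeg []       = ≤-refl
    total-nonNeg (x ∷ xs) = ≤-respˡ-≈ (+-identityˡ 0#)
      (proj₁ (size-pos (lookup js x)) +≤ total-nonNeg xs)

    total-prefix≤ : ∀ xs ys → total js xs ≤ total js (xs ++ ys)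
    total-prefix≤ xs ys = ≤-respʳ-≈ (sym (total-++ xs ys))
      (≤-respˡ-≈ (+-identityʳ _) (+-monoʳ-≤ _ (total-nonNeg ys)))

    size≤total : ∀ {i xs} → i ∈ xs → size (lookup js i) ≤ total js xs
    size≤total {xs = _ ∷ xs} (here ≡.refl) = ≤-respˡ-≈ (+-identityʳ _) (+-monoʳ-≤ _ (total-nonNeg xs))
    size≤total {xs = x ∷ xs} (there i∈xs)  = ≤-respˡ-≈ (+-identityˡ _)
      (proj₁ (size-pos (lookup js x)) +≤ size≤total i∈xs)

    total-filter : ∀ {p} {P : Pred (Fin n) p} (P? : Decidable P) xs →
      total js (filter P? xs) + total js (filter (¬? ∘ P?) xs) ≈ total js xs
    total-filter P? [] = +-identityˡ 0#
    total-filter P? (x ∷ xs) with P? x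
    ... | yes _ = trans (+-assoc _ _ _) (+-congˡ (total-filter P? xs))
    ... | no _  = trans (solve 3 (λ a s b → a :+ (s :+ b) := s :+ (a :+ b)) refl _ _ _)
      (+-congˡ (total-filter P? xs))

    total-byMachine : ∀ (σ : Schedule n) xs →
      total js (filter (λ i → σ i ≟ᴹ m₁) xs) + total js (filter (λ i → σ i ≟ᴹ m₂) xs) ≈ total js xs
    total-byMachine σ xs = trans
      (+-congˡ (≡⇒total≈
        (filter-≐ (λ i → σ i ≟ᴹ m₂) (λ i → ¬? (σ i ≟ᴹ m₁)) (on-m₂ , not-m₁) xs)))
      (total-filter (λ i → σ i ≟ᴹ m₁) xs)
      where
      on-m₂ : ∀ {i} → σ i ≡ m₂ → σ i ≢ m₁
      on-m₂ eq eq′ with () ← ≡.trans (≡.sym eq) eq′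
      not-m₁ : ∀ {i} → σ i ≢ m₁ → σ i ≡ m₂
      not-m₁ {i} ≢m₁ with σ i
      ... | m₁ = contradiction ≡.refl ≢m₁
      ... | m₂ = ≡.refl

    -- An entry of the 2 by 2 table whose row sums are the loads of `σ` and whose column sums are
    -- the loads of `τ`. The quantities `c₁₂` and `c₂₁` are its off-diagonal entries.
    cell : Schedule n → Schedule n → Machine → Machine → Carrier
    cell σ τ m m′ = total js (filter (λ i → τ i ≟ᴹ m′) (jobsOn js σ m))

    load-row : ∀ σ τ m → cell σ τ m m₁ + cell σ τ m m₂ ≈ load js σ m
    load-row σ τ m = total-byMachine τ (jobsOn js σ m)

    load-column : ∀ σ τ m′ → cell σ τ m₁ m′ + cell σ τ m₂ m′ ≈ load js τ m′
    load-column σ τ m′ rewrite filter-comm (λ i → τ i ≟ᴹ m′) (λ i → σ i ≟ᴹ m₁) (allFin n)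
                             | filter-comm (λ i → τ i ≟ᴹ m′) (λ i → σ i ≟ᴹ m₂) (allFin n)
      = total-byMachine σ (jobsOn js τ m′)

  total-map-suc : ∀ {n} (js : Jobs n) j xs → total (j ∷ js) (map suc xs) ≡ total js xs
  total-map-suc js j []       = ≡.refl
  total-map-suc js j (x ∷ xs) = cong (size (lookup js x) +_) (total-map-suc js j xs)

  module _ {n} (js : Jobs n) (j : Job) where

    private
      jobsOn-suc : ∀ (σ : Schedule (suc n)) m →
        filter (λ i → σ i ≟ᴹ m) (tabulate suc) ≡ map suc (jobsOn js (σ ∘ suc) m)
      jobsOn-suc σ m = ≡.trans (cong (filter _) (≡.sym (map-tabulate (λ i → i) suc)))
        (filter-map _ suc (allFin n))

      total-filter-suc : ∀ {p} {P : Pred (Fin (suc n)) p} (P? : Decidable P) xs →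
        total (j ∷ js) (filter P? (map suc xs)) ≡ total js (filter (P? ∘ suc) xs)
      total-filter-suc P? xs = ≡.trans (cong (total (j ∷ js)) (filter-map P? suc xs))
        (total-map-suc js j (filter (P? ∘ suc) xs))

    -- The machine of the new job is a variable tied by an equation, so that with a concrete machine
    -- the conditional computes away even for an abstract schedule.
    load-∷ : ∀ (σ : Schedule (suc n)) m {a} → σ zero ≡ a → load (j ∷ js) σ m ≡
      (if does (a ≟ᴹ m) then size j + load js (σ ∘ suc) m else load js (σ ∘ suc) m)
    load-∷ σ m ≡.refl with does (σ zero ≟ᴹ m)
    ... | true  rewrite jobsOn-suc σ m = cong (size j +_) (total-map-suc js j (jobsOn js (σ ∘ suc) m))
    ... | false rewrite jobsOn-suc σ m = total-map-suc js j (jobsOn js (σ ∘ suc) m)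

    cell-∷ : ∀ (σ τ : Schedule (suc n)) m m′ {a b} → σ zero ≡ a → τ zero ≡ b →
      cell (j ∷ js) σ τ m m′ ≡
      (if does (a ≟ᴹ m) ∧ does (b ≟ᴹ m′)
       then size j + cell js (σ ∘ suc) (τ ∘ suc) m m′
       else cell js (σ ∘ suc) (τ ∘ suc) m m′)
    cell-∷ σ τ m m′ ≡.refl ≡.refl with does (σ zero ≟ᴹ m)
    ... | false rewrite jobsOn-suc σ m = total-filter-suc _ (jobsOn js (σ ∘ suc) m)
    ... | true with does (τ zero ≟ᴹ m′)
    ...   | true  rewrite jobsOn-suc σ m = cong (size j +_) (total-filter-suc _ (jobsOn js (σ ∘ suc) m))
    ...   | false rewrite jobsOn-suc σ m = total-filter-suc _ (jobsOn js (σ ∘ suc) m)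

-- Analysis of a single decision.

module Decisions {c ℓ₁ ℓ₂} (F : OrderedField c ℓ₁ ℓ₂) where

  open OrderedField F
  open BinStretching F
  open OrderedFieldProperties F
  open TotalProperties F

  module _ (sorting : Sorting) {n} (js : Jobs n) (σ : Schedule n) (j : Job) where

    open AlgorithmB sorting using (module Step)
    open Step js σ j
    open SortingAlgorithm (sorting js) using (sort-↭; sort-↗)
    open import Data.List.Membership.DecPropositional (Fin._≟_ {n}) using (_∈?_)

    -- The jobs of L are too large to share a machine with the rejected job in a
    -- schedule of makespan at most 1.
    record Rejected : Set (c ⊔ ℓ₁ ⊔ ℓ₂) where
      field
        size>½   : ¼ + ¼ < p
        blocking : p ≤ 1# → ∃[ L ] ∃[ Z ] L ++ Z ≡ sortedY ×
          All (λ i → 1# < p + size (lookup js i)) L × ¼ + ¼ < total js L × p ≤ ¼ + total js L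

    -- With `z` the load that stays on `m₂`, the conditions bound the migration, written without
    -- subtraction, and the new load of `m₂` from above and below. The lower bound sends all later
    -- jobs to `m₁`.
    Exchangeable : List (Fin n) → Set ℓ₂
    Exchangeable W = y ≤ z + ¾ * p × z + p ≤ 5/4 × ¾ ≤ z + p
      where
      z : Carrier
      z = total js (Y ∖ W)

    -- All that later arguments use of a decision. The three reasons for choosing `m₁` are kept
    -- apart because the invariant survives each in a different way.
    data Outcome : Decision n → Set (c ⊔ ℓ₁ ⊔ ℓ₂) where
      restricted : gos j ≡ gos₁ → Outcome assign-m₁
      saturated  : ¾ ≤ y → Outcome assign-m₁
      rejected   : Rejected → Outcome assign-m₁
      accepted   : gos j ≢ gos₁ → y + p ≤ 5/4 → Outcome (migrate [] andAssign-m₂)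
      exchanged  : ∀ {W} → gos j ≢ gos₁ → Exchangeable W → Outcome (migrate W andAssign-m₂)

    private

      uniqueY : Unique sortedY
      uniqueY = Permutation.Unique-resp-↭ (≡.setoid (Fin n)) (↭⇒↭ₛ (↭-sym (sort-↭ Y)))
        (Unique.filter⁺ (λ i → σ i ≟ᴹ m₂) (Unique.allFin⁺ n))

      descendingY : AllPairs (λ i i′ → size (lookup js i′) ≤ size (lookup js i)) sortedY
      descendingY = Sorted⇒AllPairs (bySize js) (sort-↗ Y)

      total-sortedY : total js sortedY ≈ y
      total-sortedY = total-↭ js (sort-↭ Y)

      module _ W Z (split : W ++ Z ≡ sortedY) where

        total-split : total js W + total js Z ≈ y
        total-split = trans (sym (total-++ js W Z)) (trans (≡⇒total≈ js split) total-sortedY)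

        private
          disjoint : ∀ {i} → i ∈ Z → i ∉ W
          disjoint i∈Z i∈W = All.lookup
            (All.lookup (AllPairs-++⁻ W (subst Unique (≡.sym split) uniqueY)) i∈W) i∈Z ≡.refl

          total-filter-split : ∀ {p xs} {P : Pred (Fin n) p} (P? : Decidable P) →
            filter P? W ++ filter P? Z ≡ xs → total js (filter P? Y) ≈ total js xs
          total-filter-split P? eq = trans (total-↭ js (filter-↭ P? (↭-sym (sort-↭ Y))))
            (≡⇒total≈ js (≡.trans (cong (filter P?) (≡.sym split)) (≡.trans (filter-++ P? W Z) eq)))

        -- No job occurs twice in `sortedY`, so removing the jobs of a prefix leaves exactly the
        -- rest.
        total-∖-prefix : total js (Y ∖ W) ≈ total js Z
        total-∖-prefix = total-filter-split (λ i → ¬? (i ∈? W)) (≡.cong₂ _++_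
          (filter-none (λ i → ¬? (i ∈? W)) (All.tabulate λ i∈W i∉W → i∉W i∈W))
          (filter-all (λ i → ¬? (i ∈? W)) (All.tabulate disjoint)))

        -- Gives the load that stays on `m₂` when the complement of a prefix migrates. Membership is
        -- compared only inside `Y`, where a double complement is the prefix again.
        total-∖-∖-prefix : total js (Y ∖ (Y ∖ W)) ≈ total js W
        total-∖-∖-prefix = trans
          (≡⇒total≈ js (filter-cong-∈ (λ i → ¬? (i ∈? (Y ∖ W))) (_∈? W) Y outside inside))
          (total-filter-split (_∈? W) (≡.trans
            (≡.cong₂ _++_ (filter-all (_∈? W) (All.tabulate λ i∈W → i∈W))
                          (filter-none (_∈? W) (All.tabulate disjoint)))
            (++-identityʳ W)))
          where
          inside : ∀ {i} → i ∈ Y → i ∈ W → i ∉ Y ∖ W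
          inside _ i∈W i∈Y∖W = proj₂ (∈-filter⁻ (λ i → ¬? (i ∈? W)) {xs = Y} i∈Y∖W) i∈W
          outside : ∀ {i} → i ∈ Y → i ∉ Y ∖ W → i ∈ W
          outside {i} i∈Y i∉Y∖W = decidable-stable (i ∈? W) λ i∉W →
            i∉Y∖W (∈-filter⁺ (λ i → ¬? (i ∈? W)) i∈Y i∉W)

        total-prefix+∖ : total js W + total js (Y ∖ W) ≈ y
        total-prefix+∖ = trans (+-congˡ total-∖-prefix) total-split

      longestPrefix : ∀ b → 0# ≤ b → let W = longestPrefix≤ b in
        ∃[ Z ] W ++ Z ≡ sortedY × total js W ≤ b ×
          (∀ {i Z′} → Z ≡ i ∷ Z′ → ¬ total js (W ++ [ i ]) ≤ b)
      longestPrefix b 0≤b = go (lastPrefix (λ W → total js W ≤? b) sortedY)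
        where
        go : ∀ {m} → LastPrefix (λ W → total js W ≤ b) sortedY m → let W = fromMaybe [] m in
          ∃[ Z ] W ++ Z ≡ sortedY × total js W ≤ b ×
            (∀ {i Z′} → Z ≡ i ∷ Z′ → ¬ total js (W ++ [ i ]) ≤ b)
        -- The default of `fromMaybe` is never reached, since the empty prefix has total `0#`.
        go (none ¬0≤b)             = contradiction 0≤b ¬0≤b
        go (some Z split fits max) = Z , split , fits , max

      size≤pmaxY : ∀ {W i Z} → W ++ i ∷ Z ≡ sortedY → size (lookup js i) ≤ pmaxY
      size≤pmaxY {W} {i} {Z} split with sortedY | descendingY
      size≤pmaxY {[]}    ≡.refl | _ | _         = reflexive (sym (+-identityʳ _))
      size≤pmaxY {w ∷ W} ≡.refl | _ | below ∷ _ = ≤-respʳ-≈ (sym (+-identityʳ _))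
        (All.lookup below (∈-++⁺ʳ W (here ≡.refl)))

      -- Without its last job the prefix is below `b`, and that job adds at most `pmaxY`. The
      -- hypotheses on `b` exclude the default `Y` and the empty prefix.
      shortestPrefix : ∀ b → 0# < b → b ≤ y → let W = shortestPrefix≥ b in
        ∃[ Z ] W ++ Z ≡ sortedY × b ≤ total js W × total js W < b + pmaxY
      shortestPrefix b 0<b b≤y = go (firstPrefix (λ W → b ≤? total js W) sortedY)
        where
        go : ∀ {m} → FirstPrefix (λ W → b ≤ total js W) sortedY m → let W = fromMaybe Y m in
          ∃[ Z ] W ++ Z ≡ sortedY × b ≤ total js W × total js W < b + pmaxY
        go (none ¬b≤)  = contradiction (≤-respʳ-≈ (sym total-sortedY) b≤y) ¬b≤
        go (empty b≤0) = contradiction b≤0 (<⇒≱ 0<b)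
        go (some W i Z split ¬b≤ b≤) = Z , ≡.trans (++-assoc W [ i ] Z) split , b≤ ,
          ≤-<-trans (reflexive (trans (total-++ js W [ i ]) (+-congˡ (+-identityʳ _))))
            (≰⇒> ¬b≤ +< size≤pmaxY split)

      jmax-split : jmaxY ++ drop 1 sortedY ≡ sortedY
      jmax-split = take++drop≡id 1 sortedY

    step4-outcome : gos j ≢ gos₁ → y < ¾ → 5/4 < y + p → ¾ ≤ p → Outcome step4
    step4-outcome ≢gos₁ y<¾ y+p>5/4 ¾≤p =
      if-dec Outcome ((y - total js W) + p ≤? 5/4)
        (exchanged ≢gos₁ ∘ fits) (rejected ∘ overflows ∘ ≰⇒>)
      where
      W : List (Fin n)
      W = longestPrefix≤ (¾ * p)

      prefix = longestPrefix (¾ * p) (*-nonNeg 0≤¾ (proj₁ (size-pos j)))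
      Z = proj₁ prefix
      split = proj₁ (proj₂ prefix)

      rest : y - total js W ≈ total js Z
      rest = trans (+-congʳ (trans (sym (total-split W Z split)) (+-comm _ _))) (x+y-y≈x _ _)

      fits : (y - total js W) + p ≤ 5/4 → Exchangeable W
      fits ok = ≤-respʳ-≈ (+-congʳ z≈) (≤-respˡ-≈ (total-split W Z split)
                  (≤-respʳ-≈ (+-comm _ _) (+-monoˡ-≤ _ (proj₁ (proj₂ (proj₂ prefix))))))
              , ≤-respˡ-≈ (+-congʳ (trans rest z≈)) ok
              , ≤-respˡ-≈ (+-identityˡ _) (total-nonNeg js (Y ∖ W) +≤ ¾≤p)
        where
        z≈ : total js Z ≈ total js (Y ∖ W)
        z≈ = sym (total-∖-prefix W Z split)

      overflows : 5/4 < (y - total js W) + p → Rejected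
      overflows big = record
        { size>½   = half<job y<¾ y+p>5/4
        ; blocking = blocking Z split big′ (λ eq → proj₂ (proj₂ (proj₂ prefix)) eq)
        }
        where
        big′ : 5/4 < total js Z + p
        big′ = <-respʳ-≈ (+-congʳ rest) big

        blocking : ∀ Z → W ++ Z ≡ sortedY → 5/4 < total js Z + p →
          (∀ {i Z′} → Z ≡ i ∷ Z′ → ¬ total js (W ++ [ i ]) ≤ ¾ * p) → p ≤ 1# →
          ∃[ L ] ∃[ Z ] L ++ Z ≡ sortedY ×
          All (λ i → 1# < p + size (lookup js i)) L × ¼ + ¼ < total js L × p ≤ ¼ + total js L
        blocking []      split big max p≤1 = contradiction big (nothing-remains ¾≤p p≤1 refl)
        blocking (i ∷ Z) split big max p≤1 =
          -- The blocking jobs are `W` and the next job `i`. Together they exceed the budget by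
          -- maximality of `W`, and even `i`, a smallest of them, does not fit next to the new job.
          W ++ [ i ] , Z , split′ , All.∷ʳ⁺ (All.map larger descending) small ,
          prefix-large ¾≤p big-prefix , prefix-compensates ¾≤p big-prefix p≤1
          where
          big-prefix : ¾ * p < total js (W ++ [ i ])
          big-prefix = ≰⇒> (max ≡.refl)
          split′ : (W ++ [ i ]) ++ Z ≡ sortedY
          split′ = ≡.trans (++-assoc W [ i ] Z) split
          small : 1# < p + size (lookup js i)
          small = prefix-incompatible ¾≤p big-prefix (total-split W (i ∷ Z) split) y<¾ big
            (trans (total-++ js W [ i ]) (+-congˡ (+-identityʳ _)))
          descending : All (λ i′ → size (lookup js i) ≤ size (lookup js i′)) W
          descending = All.map All.head (AllPairs-++⁻ W (subst (AllPairs _) (≡.sym split) descendingY))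
          larger : ∀ {i′} → size (lookup js i) ≤ size (lookup js i′) → 1# < p + size (lookup js i′)
          larger le = <-≤-trans small (+-monoʳ-≤ p le)

    step5-outcome : gos j ≢ gos₁ → y < ¾ → 5/4 < y + p → p < ¾ → Outcome step5
    step5-outcome ≢gos₁ y<¾ y+p>5/4 p<¾ =
      if-dec Outcome (p + pmaxY ≤? 5/4)
        (exchanged ≢gos₁ ∘ exchange) (rejected ∘ reject ∘ ≰⇒>)
      where
      size>½ : ¼ + ¼ < p
      size>½ = half<job y<¾ y+p>5/4

      reject : 5/4 < p + pmaxY → Rejected
      reject big = record
        { size>½   = size>½
        -- A largest job blocks by itself: as `p < ¾`, a sum above `5/4` forces it above `½`.
        ; blocking = λ _ → jmaxY , drop 1 sortedY , jmax-split , single sortedY (exceeds-one big) ,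
            half<job p<¾ big , rejected-small p<¾ (half<job p<¾ big)
        }
        where
        single : ∀ xs → 1# < p + total js (take 1 xs) → All (λ i → 1# < p + size (lookup js i)) (take 1 xs)
        single []      lt = []
        single (x ∷ _) lt = <-respʳ-≈ (+-congˡ (+-identityʳ _)) lt ∷ []

      exchange : p + pmaxY ≤ 5/4 → Exchangeable W₅
      exchange p+pmax≤5/4 =
        if-dec Exchangeable (½ * y ≤? pmaxY) keep-largest λ small →
        if-dec Exchangeable (¼ ≤? pmaxY) (move-largest (≰⇒> small)) λ tiny →
        if-dec Exchangeable (total js V ≤? ¾ * p)
          (move-prefix (≰⇒> tiny)) (λ big → keep-prefix (≰⇒> tiny) (≰⇒> big))
        where
        V : List (Fin n)
        V = shortestPrefix≥ ¼

        -- A job of at least half the load stays, so at most half the load moves; the test on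
        -- `p + pmaxY` is the upper bound on the new load.
        keep-largest : ½ * y ≤ pmaxY → Exchangeable (Y ∖ jmaxY)
        keep-largest ½y≤pmax =
            half-migration p<¾ y<¾ y+p>5/4 rest+kept≈y 2rest≤y
          , ≤-respˡ-≈ (trans (+-comm p pmaxY) (+-congʳ (sym kept≈pmax))) p+pmax≤5/4
          , half-remaining p<¾ y<¾ y+p>5/4 rest+kept≈y 2rest≤y
          where
          kept≈pmax : total js (Y ∖ (Y ∖ jmaxY)) ≈ pmaxY
          kept≈pmax = total-∖-∖-prefix jmaxY (drop 1 sortedY) jmax-split
          rest : Carrier
          rest = total js (drop 1 sortedY)
          pmax+rest≈y : pmaxY + rest ≈ y
          pmax+rest≈y = total-split jmaxY (drop 1 sortedY) jmax-split
          rest+kept≈y : rest + total js (Y ∖ (Y ∖ jmaxY)) ≈ y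
          rest+kept≈y = trans (+-congˡ kept≈pmax) (trans (+-comm rest pmaxY) pmax+rest≈y)
          2rest≤y : rest + rest ≤ y
          2rest≤y = ≤-respʳ-≈ pmax+rest≈y (+-monoˡ-≤ rest (+-cancelʳ-≤ pmaxY
            (≤-respˡ-≈ (trans (sym pmax+rest≈y) (+-comm pmaxY rest)) (below-half ½y≤pmax))))

        -- Moving at least `¼` makes enough room; moving at most half respects the budget and keeps
        -- `m₂` sufficiently full.
        move-largest : pmaxY < ½ * y → ¼ ≤ pmaxY → Exchangeable jmaxY
        move-largest pmax<½y ¼≤pmax =
            half-migration p<¾ y<¾ y+p>5/4 pmax+kept≈y 2pmax≤y
          , remaining-small p<¾ y<¾ y+p>5/4 pmax+kept≈y ¼≤pmax
          , half-remaining p<¾ y<¾ y+p>5/4 pmax+kept≈y 2pmax≤y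
          where
          pmax+kept≈y : pmaxY + total js (Y ∖ jmaxY) ≈ y
          pmax+kept≈y = total-prefix+∖ jmaxY (drop 1 sortedY) jmax-split
          2pmax≤y : pmaxY + pmaxY ≤ y
          2pmax≤y = proj₁ (above-half pmax<½y)

        -- `half<job` with `p` and `y` exchanged gives even `½ < y`. The bound ensures that some
        -- prefix reaches `¼`.
        ¼≤y : ¼ ≤ y
        ¼≤y = ≤-trans (≤-respˡ-≈ (+-identityʳ ¼) (+-monoʳ-≤ ¼ 0≤¼))
          (proj₁ (half<job p<¾ (<-respʳ-≈ (+-comm y p) y+p>5/4)))

        prefix = shortestPrefix ¼ 0<¼ ¼≤y
        split = proj₁ (proj₂ prefix)
        ¼≤V = proj₁ (proj₂ (proj₂ prefix))

        -- Jobs smaller than `¼` overshoot the target `¼` by less than `¼`.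
        V<½ : pmaxY < ¼ → total js V < ¼ + ¼
        V<½ pmax<¼ = <-≤-trans (proj₂ (proj₂ (proj₂ prefix))) (+-monoʳ-≤ ¼ (proj₁ pmax<¼))

        move-prefix : pmaxY < ¼ → total js V ≤ ¾ * p → Exchangeable V
        move-prefix pmax<¼ V≤¾p =
            small-migration p<¾ y<¾ y+p>5/4 V+kept≈y V≤¾p
          , remaining-small p<¾ y<¾ y+p>5/4 V+kept≈y ¼≤V
          , remaining-large p<¾ y<¾ y+p>5/4 V+kept≈y (V<½ pmax<¼)
          where
          V+kept≈y : total js V + total js (Y ∖ V) ≈ y
          V+kept≈y = total-prefix+∖ V (proj₁ prefix) split

        -- `V` now stays. Being below `½` it leaves room for `p < ¾`, and being at least `¼` it
        -- reaches `¾` together with `p > ½`.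
        keep-prefix : pmaxY < ¼ → ¾ * p < total js V → Exchangeable (Y ∖ V)
        keep-prefix pmax<¼ ¾p<V =
            kept-prefix-migration p<¾ y<¾ y+p>5/4 (<-respʳ-≈ V≈ ¾p<V)
          , kept-prefix-small p<¾ y<¾ y+p>5/4 (≤-<-trans (reflexive (sym V≈)) (V<½ pmax<¼))
          , kept-prefix-large p<¾ y<¾ y+p>5/4 (≤-respʳ-≈ V≈ ¼≤V)
          where
          V≈ : total js V ≈ total js (Y ∖ (Y ∖ V))
          V≈ = sym (total-∖-∖-prefix V (proj₁ prefix) split)

    outcome : Outcome decision
    outcome =
      -- The Boolean disjunction in `decision` is, by computation, `does` of this disjunction of
      -- decisions.
      if-dec Outcome ((gos j ≟ᴳ gos₁) ⊎-dec (¾ ≤? y)) Sum.[ restricted , saturated ] λ neither →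
      if-dec Outcome (y + p ≤? 5/4) (accepted (neither ∘ inj₁)) λ over →
      if-dec Outcome (¾ ≤? p)
        (step4-outcome (neither ∘ inj₁) (≰⇒> (neither ∘ inj₂)) (≰⇒> over))
        (λ small → step5-outcome (neither ∘ inj₁) (≰⇒> (neither ∘ inj₂)) (≰⇒> over) (≰⇒> small))

-- Effect of one step on feasibility, migration and the load of `m₂`.

module Guarantees {c ℓ₁ ℓ₂} (F : OrderedField c ℓ₁ ℓ₂) where

  open OrderedField F
  open BinStretching F
  open OrderedFieldProperties F
  open TotalProperties F
  open Decisions F
  open Max totalOrder using (⊔-lub; x≤x⊔y; x≤y⊔x)

  module _ (sorting : Sorting) {n} (js : Jobs n) (σ : Schedule n) (j : Job) where

    open AlgorithmB sorting using (module Step)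
    open Step js σ j using (p; y; Y; sortedY)
    open SortingAlgorithm (sorting js) using (sort-↭)
    open import Data.List.Membership.DecPropositional (Fin._≟_ {n}) using (_∈?_)

    private
      Outcome′ : Decision n → Set _
      Outcome′ = Outcome sorting js σ j

    execute-feasible : ∀ {d} → Outcome′ d → Feasible js σ → Feasible (j ∷ js) (execute σ d)
    execute-feasible (restricted _)       feasible zero    _  = ≡.refl
    execute-feasible (saturated _)        feasible zero    _  = ≡.refl
    execute-feasible (rejected _)         feasible zero    _  = ≡.refl
    execute-feasible (accepted ≢gos₁ _)   feasible zero    eq = contradiction eq ≢gos₁
    execute-feasible (exchanged ≢gos₁ _)  feasible zero    eq = contradiction eq ≢gos₁
    execute-feasible (restricted _)       feasible (suc i) eq = feasible i eq
    execute-feasible (saturated _)        feasible (suc i) eq = feasible i eq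
    execute-feasible (rejected _)         feasible (suc i) eq = feasible i eq
    execute-feasible (accepted _ _)       feasible (suc i) eq = feasible i eq
    execute-feasible (exchanged {W} _ _)  feasible (suc i) eq with does (i ∈? W)
    ... | true  = ≡.refl
    ... | false = feasible i eq

    remaining : ∀ W → jobsOn js (execute σ (migrate W andAssign-m₂) ∘ suc) m₂ ≡ Y ∖ W
    remaining W = filter-∧ (λ i → ¬? (i ∈? W)) (λ i → σ i ≟ᴹ m₂) _ stays (allFin n)
      where
      stays : ∀ i → does (execute σ (migrate W andAssign-m₂) (suc i) ≟ᴹ m₂) ≡
        does (σ i ≟ᴹ m₂) ∧ does (¬? (i ∈? W))
      stays i with does (i ∈? W) | σ i
      ... | true  | m₁ = ≡.refl
      ... | true  | m₂ = ≡.refl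
      ... | false | m₁ = ≡.refl
      ... | false | m₂ = ≡.refl

    migrated-from-m₂ : ∀ W → migrated σ (execute σ (migrate W andAssign-m₂)) ≡ filter (_∈? W) Y
    migrated-from-m₂ W = filter-∧ (_∈? W) (λ i → σ i ≟ᴹ m₂) _ moves (allFin n)
      where
      moves : ∀ i → does (¬? (σ i ≟ᴹ execute σ (migrate W andAssign-m₂) (suc i))) ≡
        does (σ i ≟ᴹ m₂) ∧ does (i ∈? W)
      moves i with does (i ∈? W) | σ i
      ... | true  | m₁ = ≡.refl
      ... | true  | m₂ = ≡.refl
      ... | false | m₁ = ≡.refl
      ... | false | m₂ = ≡.refl

    execute-migration : ∀ {d} → Outcome′ d → total js (migrated σ (execute σ d)) ≤ ¾ * p
    execute-migration = λ where
        (restricted _)          → nothing-moves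
        (saturated _)           → nothing-moves
        (rejected _)            → nothing-moves
        (accepted _ _)          → nothing-moves
        -- The load `y` splits into the part that moves and the part that stays; the latter is
        -- cancelled.
        (exchanged {W} _ (y≤ , _)) → +-cancelʳ-≤ (total js (Y ∖ W)) (≤-respˡ-≈
          (trans (sym (total-filter js (_∈? W) Y))
            (+-congʳ (≡⇒total≈ js (≡.sym (migrated-from-m₂ W)))))
          (≤-respʳ-≈ (+-comm _ _) y≤))
      where
      nothing-moves : total js (filter (λ i → ¬? (σ i ≟ᴹ σ i)) (allFin n)) ≤ ¾ * p
      nothing-moves rewrite filter-none (λ i → ¬? (σ i ≟ᴹ σ i)) {allFin n}
                            (All.tabulate λ _ ≢ → ≢ ≡.refl)
        = *-nonNeg 0≤¾ (proj₁ (size-pos j))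

    load-exchanged : ∀ W →
      load (j ∷ js) (execute σ (migrate W andAssign-m₂)) m₂ ≡ p + total js (Y ∖ W)
    load-exchanged W = ≡.trans (load-∷ js j (execute σ (migrate W andAssign-m₂)) m₂ ≡.refl)
      (cong (λ is → p + total js is) (remaining W))

    load-assigned-m₁ : load (j ∷ js) (execute σ assign-m₁) m₂ ≡ y
    load-assigned-m₁ = load-∷ js j (execute σ assign-m₁) m₂ ≡.refl

    load-assigned-m₂ : load (j ∷ js) (execute σ (migrate [] andAssign-m₂)) m₂ ≡ p + y
    load-assigned-m₂ = load-∷ js j (execute σ (migrate [] andAssign-m₂)) m₂ ≡.refl

    execute-load-m₂ : ∀ {d} → Outcome′ d → y ≤ 5/4 → load (j ∷ js) (execute σ d) m₂ ≤ 5/4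
    execute-load-m₂ = λ where
        (restricted _)         → via-m₁
        (saturated _)          → via-m₁
        (rejected _)           → via-m₁
        (accepted _ fits)    _ →
          ≤-respˡ-≈ (trans (+-comm y p) (≡⇒≈ (≡.sym load-assigned-m₂))) fits
        (exchanged {W} _ (_ , fits , _)) _ →
          ≤-respˡ-≈ (trans (+-comm _ p) (≡⇒≈ (≡.sym (load-exchanged W)))) fits
      where
      via-m₁ : y ≤ 5/4 → load (j ∷ js) (execute σ assign-m₁) m₂ ≤ 5/4
      via-m₁ = ≤-respˡ-≈ (≡⇒≈ (≡.sym load-assigned-m₁))

  -- Comparison with a schedule of loads at most 1.

  record Fits {n} (js : Jobs n) (τ : Schedule n) : Set (ℓ₁ ⊔ ℓ₂) where
    field
      feasible : Feasible js τ
      load≤1   : ∀ m → load js τ m ≤ 1#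

  open Fits

  load-∷-≤ : ∀ {n} (js : Jobs n) j τ m → load js (τ ∘ suc) m ≤ load (j ∷ js) τ m
  load-∷-≤ js j τ m rewrite load-∷ js j τ m ≡.refl with does (τ zero ≟ᴹ m)
  ... | true  = ≤-respˡ-≈ (+-identityˡ _) (+-monoˡ-≤ _ (proj₁ (size-pos j)))
  ... | false = ≤-refl

  -- Bounds by 1 pass to the earlier jobs, whereas an optimum equal to 1 need not; hence `Fits` does
  -- not ask for optimality.
  Fits-tail : ∀ {n} {js : Jobs n} {j τ} → Fits (j ∷ js) τ → Fits js (τ ∘ suc)
  Fits-tail {js = js} {j} {τ} fits = record
    { feasible = λ i → feasible fits (suc i)
    ; load≤1   = λ m → ≤-trans (load-∷-≤ js j τ m) (load≤1 fits m)
    }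

  -- Either `m₂` is full enough for good, or no job that `τ` has on `m₂` is on `m₁`, or such jobs
  -- are present and compensated up to `¼`. In the last case `½ < c₁₂` excludes a further such
  -- rejection.
  data Invariant {n} (js : Jobs n) (σ τ : Schedule n) : Set (ℓ₁ ⊔ ℓ₂) where
    saturated : ¾ ≤ load js σ m₂ → Invariant js σ τ
    unmixed   : cell js σ τ m₁ m₂ ≈ 0# → Invariant js σ τ
    balanced  : ¼ + ¼ < cell js σ τ m₁ m₂ → ¼ + ¼ < cell js σ τ m₂ m₁ →
                cell js σ τ m₁ m₂ ≤ ¼ + cell js σ τ m₂ m₁ → Invariant js σ τ

  module _ (sorting : Sorting) {n} (js : Jobs n) (σ : Schedule n) (j : Job) where

    open AlgorithmB sorting using (module Step)
    open Step js σ j using (p; y; Y; sortedY)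
    open SortingAlgorithm (sorting js) using (sort-↭)

    module _ {τ : Schedule (suc n)} (fits : Fits (j ∷ js) τ) where

      private
        τ′ : Schedule n
        τ′ = τ ∘ suc

      module _ (τ≡m₂ : τ zero ≡ m₂) where

        shared-load : p + load js τ′ m₂ ≤ 1#
        shared-load = ≤-respˡ-≈ (≡⇒≈ (load-∷ js j τ m₂ τ≡m₂)) (load≤1 fits m₂)

        p≤1 : p ≤ 1#
        p≤1 = ≤-trans
          (≤-respˡ-≈ (+-identityʳ p) (+-monoʳ-≤ p (total-nonNeg js (jobsOn js τ′ m₂))))
          shared-load

        -- As `τ` has the new job on `m₂` with load at most 1, it has each job of `L` on `m₁`; these
        -- jobs, on `m₂` under `σ`, count in `c₂₁`.
        blocking-total : ∀ L Z → L ++ Z ≡ sortedY → All (λ i → 1# < p + size (lookup js i)) L →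
          total js L ≤ cell js σ τ′ m₂ m₁
        blocking-total L Z split large = ≤-respʳ-≈
          (trans (≡⇒total≈ js (≡.trans (≡.trans L-on-m₁ (≡.sym (filter-++ on-m₁ L Z)))
                                       (cong (filter on-m₁) split)))
                 (total-↭ js (filter-↭ on-m₁ (sort-↭ Y))))
          (total-prefix≤ js L (filter on-m₁ Z))
          where
          on-m₁ : ∀ i → Dec (τ′ i ≡ m₁)
          on-m₁ i = τ′ i ≟ᴹ m₁
          elsewhere : ∀ {i} → 1# < p + size (lookup js i) → τ′ i ≡ m₁
          elsewhere {i} lt with τ′ i in eq
          ... | m₁ = ≡.refl
          ... | m₂ = contradiction (≤-trans (+-monoʳ-≤ p
            (size≤total js (∈-filter⁺ (λ i → τ′ i ≟ᴹ m₂) (∈-allFin i) eq))) shared-load) (<⇒≱ lt)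
          L-on-m₁ : L ++ filter on-m₁ Z ≡ filter on-m₁ L ++ filter on-m₁ Z
          L-on-m₁ = cong (_++ filter on-m₁ Z) (≡.sym (filter-all on-m₁ (All.map elsewhere large)))

      module _ {d : Decision n} where

        -- Covers the steps that leave `c₁₂` unchanged and decrease neither `c₂₁` nor the load of
        -- `m₂`.
        Invariant-mono : load js σ m₂ ≤ load (j ∷ js) (execute σ d) m₂ →
          cell js σ τ′ m₁ m₂ ≡ cell (j ∷ js) (execute σ d) τ m₁ m₂ →
          cell js σ τ′ m₂ m₁ ≤ cell (j ∷ js) (execute σ d) τ m₂ m₁ →
          Invariant js σ τ′ → Invariant (j ∷ js) (execute σ d) τ
        Invariant-mono y≤ c₁₂≡ c₂₁≤ (saturated ¾≤y) = saturated (≤-trans ¾≤y y≤)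
        Invariant-mono y≤ c₁₂≡ c₂₁≤ (unmixed c₁₂≈0) = unmixed (trans (≡⇒≈ (≡.sym c₁₂≡)) c₁₂≈0)
        Invariant-mono y≤ c₁₂≡ c₂₁≤ (balanced ½<c₁₂ ½<c₂₁ c₁₂≤) = balanced
          (<-respʳ-≈ (≡⇒≈ c₁₂≡) ½<c₁₂) (<-≤-trans ½<c₂₁ c₂₁≤)
          (≤-respˡ-≈ (≡⇒≈ c₁₂≡) (≤-trans c₁₂≤ (+-monoʳ-≤ ¼ c₂₁≤)))

      assign-m₁-invariant : τ zero ≡ m₁ → Invariant js σ τ′ →
        Invariant (j ∷ js) (execute σ assign-m₁) τ
      assign-m₁-invariant τ≡m₁ = Invariant-mono {d = assign-m₁}
        (reflexive (≡⇒≈ (≡.sym (load-assigned-m₁ sorting js σ j))))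
        (≡.sym (cell-∷ js j (execute σ assign-m₁) τ m₁ m₂ ≡.refl τ≡m₁))
        (reflexive (≡⇒≈ (≡.sym (cell-∷ js j (execute σ assign-m₁) τ m₂ m₁ ≡.refl τ≡m₁))))

      assign-m₂-invariant : Invariant js σ τ′ →
        Invariant (j ∷ js) (execute σ (migrate [] andAssign-m₂)) τ
      assign-m₂-invariant = Invariant-mono {d = migrate [] andAssign-m₂}
        (load-∷-≤ js j σ′ m₂)
        (≡.sym (cell-∷ js j σ′ τ m₁ m₂ ≡.refl ≡.refl))
        c₂₁≤
        where
        σ′ = execute σ (migrate [] andAssign-m₂)
        c₂₁≤ : cell js σ τ′ m₂ m₁ ≤ cell (j ∷ js) σ′ τ m₂ m₁
        c₂₁≤ rewrite cell-∷ js j σ′ τ m₂ m₁ ≡.refl ≡.refl with does (τ zero ≟ᴹ m₁)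
        ... | true  = ≤-respˡ-≈ (+-identityˡ _) (+-monoˡ-≤ _ (proj₁ (size-pos j)))
        ... | false = ≤-refl

      reject-invariant : Rejected sorting js σ j → τ zero ≡ m₂ →
        Invariant js σ τ′ → Invariant (j ∷ js) (execute σ assign-m₁) τ
      reject-invariant rej τ≡m₂ (saturated ¾≤y) =
        saturated (≤-respʳ-≈ (≡⇒≈ (≡.sym (load-assigned-m₁ sorting js σ j))) ¾≤y)
      -- As `c₁₂` was zero it becomes `p`, and the blocking jobs supply the compensation in `c₂₁`.
      reject-invariant rej τ≡m₂ (unmixed c₁₂≈0) with Rejected.blocking rej (p≤1 τ≡m₂)
      ... | L , Z , split , large , ½<L , p≤¼+L = balanced
        (<-respʳ-≈ (sym c₁₂≈p) (Rejected.size>½ rej))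
        (<-≤-trans ½<L L≤c₂₁)
        (≤-respˡ-≈ (sym c₁₂≈p) (≤-trans p≤¼+L (+-monoʳ-≤ ¼ L≤c₂₁)))
        where
        σ′ = execute σ assign-m₁
        c₁₂≈p : cell (j ∷ js) σ′ τ m₁ m₂ ≈ p
        c₁₂≈p = trans (≡⇒≈ (cell-∷ js j σ′ τ m₁ m₂ ≡.refl τ≡m₂)) (trans (+-congˡ c₁₂≈0) (+-identityʳ p))
        L≤c₂₁ : total js L ≤ cell (j ∷ js) σ′ τ m₂ m₁
        L≤c₂₁ = ≤-respʳ-≈ (≡⇒≈ (≡.sym (cell-∷ js j σ′ τ m₂ m₁ ≡.refl τ≡m₂)))
          (blocking-total τ≡m₂ L Z split large)
      -- The new job and the jobs counted in `c₁₂` share `m₂` in `τ`, but each of the two amounts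
      -- exceeds `½`.
      reject-invariant rej τ≡m₂ (balanced ½<c₁₂ _ _) = contradiction (shared-load τ≡m₂)
        (two-large (Rejected.size>½ rej) (<-≤-trans ½<c₁₂ c₁₂≤load))
        where
        c₁₂≤load : cell js σ τ′ m₁ m₂ ≤ load js τ′ m₂
        c₁₂≤load = ≤-respʳ-≈ (load-column js σ τ′ m₂) (≤-respˡ-≈ (+-identityʳ _)
          (+-monoʳ-≤ _ (total-nonNeg js (filter (λ i → τ′ i ≟ᴹ m₂) Y))))

      execute-invariant : ∀ {d} → Outcome sorting js σ j d → Invariant js σ τ′ →
        Invariant (j ∷ js) (execute σ d) τ
      -- The grade of service forces `τ` to use `m₁` as well.
      execute-invariant (restricted gos≡) = assign-m₁-invariant (feasible fits zero gos≡)
      execute-invariant (saturated ¾≤y) _ =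
        saturated (≤-respʳ-≈ (≡⇒≈ (≡.sym (load-assigned-m₁ sorting js σ j))) ¾≤y)
      execute-invariant (rejected rej) with τ zero in eq
      ... | m₁ = assign-m₁-invariant eq
      ... | m₂ = reject-invariant rej eq
      execute-invariant (accepted _ _) = assign-m₂-invariant
      execute-invariant (exchanged {W} _ (_ , _ , ¾≤z+p)) _ = saturated
        (≤-respʳ-≈ (trans (+-comm _ p) (≡⇒≈ (≡.sym (load-exchanged sorting js σ j W)))) ¾≤z+p)

  -- Unless `m₂` is saturated, the row of `m₁` gives the load `c₁₁ + c₁₂` and the column of `m₁`
  -- gives `c₁₁ + c₂₁ ≤ 1`, so `c₁₂ ≤ ¼ + c₂₁` suffices.
  Invariant⇒load-m₁ : ∀ {n} (js : Jobs n) σ {τ} → Fits js τ → Invariant js σ τ →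
    load js σ m₁ ≤ 5/4
  Invariant⇒load-m₁ js σ {τ} fits = λ where
      (saturated ¾≤y) → load-within-two total-load (load≤1 fits m₁) (load≤1 fits m₂) ¾≤y
      (unmixed c₁₂≈0) → bound (≤-respˡ-≈ (trans (+-identityˡ 0#) (sym c₁₂≈0))
        (0≤¼ +≤ total-nonNeg js (filter (λ i → τ i ≟ᴹ m₁) (jobsOn js σ m₂))))
      (balanced _ _ c₁₂≤) → bound c₁₂≤
    where
    total-load : load js σ m₁ + load js σ m₂ ≈ load js τ m₁ + load js τ m₂
    total-load = trans (total-byMachine js σ (allFin _)) (sym (total-byMachine js τ (allFin _)))
    column : cell js σ τ m₁ m₁ + cell js σ τ m₂ m₁ ≤ 1#
    column = ≤-respˡ-≈ (sym (load-column js σ τ m₁)) (load≤1 fits m₁)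
    bound : cell js σ τ m₁ m₂ ≤ ¼ + cell js σ τ m₂ m₁ → load js σ m₁ ≤ 5/4
    bound c₁₂≤ = ≤-respˡ-≈ (load-row js σ τ m₁) (balanced-load column c₁₂≤)

  -- Induction over the input and the resulting bounds.

  module _ (sorting : Sorting) where

    private
      A : Algorithm
      A = algorithmB sorting

      next : ∀ {n} (js : Jobs n) j →
        Outcome sorting js (A n js) j (AlgorithmB.Step.decision sorting js (A n js) j)
      next {n} js j = outcome sorting js (A n js) j

    algorithmB-feasible : RespectsGoS A
    algorithmB-feasible []       ()
    algorithmB-feasible (j ∷ js) =
      execute-feasible sorting js (A _ js) j (next js j) (algorithmB-feasible js)

    algorithmB-migration : HasMigrationFactor ¾ A
    algorithmB-migration js j = execute-migration sorting js (A _ js) j (next js j)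

    algorithmB-load-m₂ : ∀ {n} (js : Jobs n) → load js (A n js) m₂ ≤ 5/4
    algorithmB-load-m₂ []       = 0≤5/4
    algorithmB-load-m₂ (j ∷ js) =
      execute-load-m₂ sorting js (A _ js) j (next js j) (algorithmB-load-m₂ js)

    algorithmB-invariant : ∀ {n} (js : Jobs n) {τ} → Fits js τ → Invariant js (A n js) τ
    algorithmB-invariant []       fits = unmixed refl
    algorithmB-invariant (j ∷ js) fits =
      execute-invariant sorting js (A _ js) j fits (next js j) (algorithmB-invariant js (Fits-tail fits))

    algorithmB-makespan : ∀ {n} (js : Jobs n) {τ} → Fits js τ → makespan js (A n js) ≤ 5/4
    algorithmB-makespan js fits = ⊔-lub
      (Invariant⇒load-m₁ js (A _ js) fits (algorithmB-invariant js fits)) (algorithmB-load-m₂ js)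

  optimum-fits : ∀ {n} {js : Jobs n} {opt} → opt ≈ 1# → IsOptimalMakespan js opt →
    Σ[ τ ∈ Schedule n ] Fits js τ
  optimum-fits {js = js} opt≈1 ((τ , feasible , ≈opt) , _) = τ , record
    { feasible = feasible
    ; load≤1   = λ where
        m₁ → ≤-respʳ-≈ (trans ≈opt opt≈1) (x≤x⊔y (load js τ m₁) (load js τ m₂))
        m₂ → ≤-respʳ-≈ (trans ≈opt opt≈1) (x≤y⊔x (load js τ m₁) (load js τ m₂))
    }

  -- The existence claim needs one concrete way of breaking ties.
  mergeSorting : Sorting
  mergeSorting js = Sort.sortingAlgorithm
    (On.decTotalOrder (Flip.decTotalOrder decTotalOrder) (λ i → size (lookup js i)))

mainTheorem5 : ∀ {c ℓ₁ ℓ₂} (F : OrderedField c ℓ₁ ℓ₂) →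
  let open OrderedField F
      open BinStretching F in
  (∀ (sorting : Sorting) →
    RespectsGoS (algorithmB sorting) ×
    HasMigrationFactor ¾ (algorithmB sorting) ×
    (∀ {n} (js : Jobs n) → IsOptimalMakespan js 1# →
      makespan js (algorithmB sorting n js) ≤ 5/4)) ×
  (∀ M → ¾ ≤ M →
    Σ[ A ∈ Algorithm ]
      RespectsGoS A × HasMigrationFactor M A × HasCompetitiveRatio≤ 5/4 A)
mainTheorem5 F =
  (λ sorting → algorithmB-feasible sorting , algorithmB-migration sorting ,
    λ js opt → algorithmB-makespan sorting js (proj₂ (optimum-fits refl opt))) ,
  λ M ¾≤M → algorithmB mergeSorting , algorithmB-feasible mergeSorting ,
    (λ js j → ≤-trans (algorithmB-migration mergeSorting js j) (*-monoˡ-≤ (proj₁ (size-pos j)) ¾≤M)) ,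
    λ js opt optimal opt≈1 → ≤-respʳ-≈ (trans (sym (*-identityʳ _)) (*-congˡ (sym opt≈1)))
      (algorithmB-makespan mergeSorting js (proj₂ (optimum-fits opt≈1 optimal)))
  where
  open OrderedField F
  open BinStretching F
  open OrderedFieldProperties F
  open Guarantees F
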